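{- Let $M$ be the parallel pushdown automaton with a single state $\uparrow$, which is both initial and accepting, input alphabet $\{a,b,c\}$ (three distinct actions), data alphabet $\mathcal{D}=\{1\}$, and exactly the three transitions $$\uparrow\xrightarrow{c[-1/\{\!\{1\}\!\}]}\uparrow,\qquad \uparrow\xrightarrow{a[+1/\{\!\{1,1\}\!\}]}\uparrow,\qquad \uparrow\xrightarrow{b[+1/\emptyset]}\uparrow .$$ There is no finite weakly guarded recursive specification over $\mathrm{BPP}^{\mathbf{0}\mathbf{1}}$ (with a designated initial identifier) whose process graph is divergence-preserving branching bisimilar to the process graph $\mathcal{P}(M)$ of $M$.
   Context: **Labelled transition systems and process graphs.** A labelled transition system is a tuple $(\mathcal{S},\mathcal{A},\rightarrow,\downarrow)$ with $\mathcal{S}$ a set of states, $\mathcal{A}$ a set of actions, $\tau\notin\mathcal{A}$ the silent action, $\rightarrow\,\subseteq\mathcal{S}\times(\mathcal{A}\cup\{\tau\})\times\mathcal{S}$ the transition relation, and $\downarrow\,\subseteq\mathcal{S}$ the set of accepting (final) states; write $s\xrightarrow{a}s'$ and $s\downarrow$. A process graph is a labelled transition system with a designated root state. Write $s\Rightarrow t$ if $t$ can be reached from $s$ by zero or more $\tau$-transitions, $s\Rightarrow^{+}t$ if by one or more, and $s\xrightarrow{(a)}t$ if $s\xrightarrow{a}t$, or $a=\tau$ and $s=t$. **Divergence-preserving branching bisimilarity.** A symmetric relation $R$ on $\mathcal{S}$ is a branching bisimulation if for all $s\mathrel{R}t$ and $a\in\mathcal{A}\cup\{\tau\}$: (1)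 if $s\xrightarrow{a}s'$ then there are $t'',t'$ with $t\Rightarrow t''\xrightarrow{(a)}t'$, $s\mathrel{R}t''$ and $s'\mathrel{R}t'$; (2) if $s\downarrow$ then there is $t'$ with $t\Rightarrow t'$ and $t'\downarrow$. It is divergence-preserving if for all $s,t$, whenever there is an infinite sequence $s=s_0\xrightarrow{\tau}s_1\xrightarrow{\tau}s_2\cdots$ with $s_i\mathrel{R}t$ for all $i\geq 0$, there is $t'$ with $t\Rightarrow^{+}t'$ and $s_i\mathrel{R}t'$ for some $i\geq 0$. States $s,t$ are divergence-preserving branching bisimilar if some divergence-preserving branching bisimulation relates them. Two process graphs are divergence-preserving branching bisimilar if their roots are, in the disjoint union of the two underlying labelled transition systems. **Parallel pushdown automata.** $\mathcal{D}^{\{\!\{\,\}\!\}}$ is the set of finite multisets (bags) over $\mathcal{D}$, $\cup$ on bags is multiset sum, and $\mathcal{D}^{\pm}=\{+d\mid d\in\mathcal{D}\}\cup\{ -d\mid d\in\mathcal{D}\}$ (two disjoint copies of $\mathcal{D}$). A parallel pushdown automaton is a tuple $M=(\mathcal{S},\mathcal{A},\mathcal{D},\rightarrow,\uparrow,\downarrow)$ with $\mathcal{S}$ a finite set of states, $\mathcal{A}$ a finite input alphabet ($\tau\notin\mathcal{A}$), $\mathcal{D}$ a finite data alphabet, $\rightarrow\,\subseteq\mathcal{S}\times(\mathcal{A}\cup\{\tau\})\times\mathcal{D}^{\pm}\times\mathcal{D}^{\{\!\{\,\}\!\}}\times\mathcal{S}$ a finite set of transitions, $\uparrow\,\in\mathcal{S}$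 the initial state, and $\downarrow\,\subseteq\mathcal{S}$ the accepting states. Write $s\xrightarrow{a[+d/x]}t$ for $(s,a,+d,x,t)\in\,\rightarrow$, and $s\xrightarrow{a[-d/x]}t$ for $(s,a,-d,x,t)\in\,\rightarrow$. The process graph $\mathcal{P}(M)$ has states $(s,x)$ with $s\in\mathcal{S}$, $x\in\mathcal{D}^{\{\!\{\,\}\!\}}$; root $(\uparrow,\emptyset)$; accepting states all $(s,x)$ with $s\in\,\downarrow$; and exactly the transitions $(s,\{\!\{d\}\!\}\cup x)\xrightarrow{a}(s',x'\cup x)$ whenever $s\xrightarrow{a[+d/x']}s'$, and $(s,x)\xrightarrow{a}(s',x'\cup x)$ whenever there is $d\notin x$ with $s\xrightarrow{a[-d/x']}s'$. **Process algebra $\mathrm{BPP}^{\mathbf{0}\mathbf{1}}$.** Let $\mathcal{A}$ be a set of actions, $\tau\notin\mathcal{A}$ the silent action, and $\mathcal{P}$ a finite set of process identifiers. Process expressions are generated by $p::=\mathbf{0}\mid\mathbf{1}\mid a.p\mid p+p\mid p\parallel p\mid X$ with $a\in\mathcal{A}\cup\{\tau\}$, $X\in\mathcal{P}$. A (finite) recursive specification $\Gamma$ assigns to every $X\in\mathcal{P}$ exactly one defining equation $X\stackrel{\mathrm{def}}{=}p$ with $p$ a process expression. It is weakly guarded if every occurrence of a process identifier in the right-hand side of a defining equation is within the scope of an action prefix $a.\_$ with $a\in\mathcal{A}\cup\{\tau\}$. Relative to $\Gamma$, the transition relations $\xrightarrow{a}$ and acceptance predicate $\downarrow$ on process expressions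 are the least ones satisfying: $\mathbf{1}\downarrow$; $a.p\xrightarrow{a}p$; if $p\downarrow$ or $q\downarrow$ then $(p+q)\downarrow$; if $p\xrightarrow{a}p'$ then $p+q\xrightarrow{a}p'$ and $q+p\xrightarrow{a}p'$; if $p\downarrow$ and $q\downarrow$ then $(p\parallel q)\downarrow$; if $p\xrightarrow{a}p'$ then $p\parallel q\xrightarrow{a}p'\parallel q$ and $q\parallel p\xrightarrow{a}q\parallel p'$; if $X\stackrel{\mathrm{def}}{=}p$ and $p\xrightarrow{a}p'$ then $X\xrightarrow{a}p'$; if $X\stackrel{\mathrm{def}}{=}p$ and $p\downarrow$ then $X\downarrow$. The process graph of $\Gamma$ is this labelled transition system with the initial identifier as root. -}

module Defs where

open import Data.Fin.Base using (Fin; zero)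
open import Data.Fin.Subset using (Subset; ⁅_⁆) renaming (_∈_ to _∈ˢ_)
open import Data.List.Base using (List; []; _∷_)
open import Data.List.Membership.Propositional using (_∈_)
open import Data.List.Relation.Unary.All using (All; []; _∷_)
open import Data.List.Relation.Unary.Any using (here; there)
open import Data.Maybe.Base using (Maybe; just; nothing)
import Data.Maybe.Relation.Unary.All as Maybe
open import Data.Nat.Base using (ℕ; suc; _+_)
open import Data.Product.Base using (Σ-syntax; ∃-syntax; _×_; _,_)
open import Data.Sum.Base using (_⊎_; inj₁; inj₂; [_,_]′)
open import Data.Sum.Relation.Binary.Pointwise using (Pointwise)
open import Data.Vec.Base using (Vec; lookup; replicate; zipWith; _[_]≔_)
open import Level using (0ℓ)
open import Relation.Binary.Construct.Closure.ReflexiveTransitive using (Star)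
open import Relation.Binary.Construct.Closure.Transitive using (TransClosure)
open import Relation.Binary.Core using (Rel)
open import Relation.Binary.Definitions using (Symmetric)
open import Relation.Binary.PropositionalEquality.Core using (_≡_; refl)
open import Relation.Unary using (Pred)

Act : Set → Set
Act 𝒜 = Maybe 𝒜

pattern τ     = nothing
pattern act a = just a

record LTS (𝒜 : Set) : Set₁ where
  field
    State    : Set
    _-[_]→_  : State → Act 𝒜 → State → Set
    _↓       : Pred State 0ℓ

  _⇒_ : Rel State 0ℓ
  _⇒_ = Star (λ s t → s -[ τ ]→ t)

  _⇒⁺_ : Rel State 0ℓ
  _⇒⁺_ = TransClosure (λ s t → s -[ τ ]→ t)

  _-⦅_⦆→_ : State → Act 𝒜 → State → Set
  s -⦅ α ⦆→ t = s -[ α ]→ t ⊎ (α ≡ τ × s ≡ t)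

record ProcessGraph (𝒜 : Set) : Set₁ where
  field
    lts  : LTS 𝒜
    root : LTS.State lts

module _ {𝒜 : Set} (L : LTS 𝒜) where
  open LTS L

  record IsBranchingBisimulation (R : Rel State 0ℓ) : Set where
    field
      symmetric : Symmetric R
      step      : ∀ {s t α s′} → R s t → s -[ α ]→ s′ →
                  ∃[ t″ ] ∃[ t′ ] (t ⇒ t″ × t″ -⦅ α ⦆→ t′ × R s t″ × R s′ t′)
      accept    : ∀ {s t} → R s t → s ↓ → ∃[ t′ ] (t ⇒ t′ × t′ ↓)

  IsDivergencePreserving : Rel State 0ℓ → Set
  IsDivergencePreserving R =
    ∀ (σ : ℕ → State) (t : State) →
    (∀ i → σ i -[ τ ]→ σ (suc i)) →
    (∀ i → R (σ i) t) →
    ∃[ t′ ] (t ⇒⁺ t′ × (∃[ i ] R (σ i) t′))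

  DPBranchingBisimilar : State → State → Set₁
  DPBranchingBisimilar s t =
    Σ[ R ∈ Rel State 0ℓ ]
      (IsBranchingBisimulation R × IsDivergencePreserving R × R s t)

_⊎ᴸ_ : {𝒜 : Set} → LTS 𝒜 → LTS 𝒜 → LTS 𝒜
L ⊎ᴸ K = record
  { State   = L.State ⊎ K.State
  ; _-[_]→_ = λ s α t → Pointwise (λ p q → p L.-[ α ]→ q) (λ p q → p K.-[ α ]→ q) s t
  ; _↓      = [ L._↓ , K._↓ ]′
  }
  where
  module L = LTS L
  module K = LTS K

infix 4 _≃_

_≃_ : {𝒜 : Set} → ProcessGraph 𝒜 → ProcessGraph 𝒜 → Set₁
G ≃ H = DPBranchingBisimilar (G.lts ⊎ᴸ H.lts) (inj₁ G.root) (inj₂ H.root)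
  where
  module G = ProcessGraph G
  module H = ProcessGraph H

-- A finite multiset over Fin k is the vector of its multiplicities, so that
-- equality of bags is _≡_.
Bag : ℕ → Set
Bag k = Vec ℕ k

∅ : {k : ℕ} → Bag k
∅ {k} = replicate k 0

⟅_⟆ : {k : ℕ} → Fin k → Bag k
⟅ d ⟆ = ∅ [ d ]≔ 1

infixr 6 _∪_

_∪_ : {k : ℕ} → Bag k → Bag k → Bag k
_∪_ = zipWith _+_

infix 4 _∉ᴮ_

_∉ᴮ_ : {k : ℕ} → Fin k → Bag k → Set
d ∉ᴮ x = lookup x d ≡ 0

data _± (D : Set) : Set where
  +ᵈ_ -ᵈ_ : D → D ±

-- s -⟨ α [ e / x ]⟩→ t is the tuple (s, α, e, x, t), for an automaton with
-- n states and k data elements.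
data Transition (𝒜 : Set) (n k : ℕ) : Set where
  _-⟨_[_/_]⟩→_ : Fin n → Act 𝒜 → Fin k ± → Bag k → Fin n → Transition 𝒜 n k

label : {𝒜 : Set} {n k : ℕ} → Transition 𝒜 n k → Act 𝒜
label (_ -⟨ α [ _ / _ ]⟩→ _) = α

-- The finite input alphabet is a list of elements of the ambient set 𝒜 of
-- actions, so that automata and specifications, whose set of actions need not
-- be finite, give process graphs over the same 𝒜.
record PPA (𝒜 : Set) : Set where
  field
    #states     : ℕ
    #data       : ℕ
    alphabet    : List 𝒜
    transitions : List (Transition 𝒜 #states #data)
    labels      : All (λ θ → Maybe.All (_∈ alphabet) (label θ)) transitions
    initial     : Fin #states
    accepting   : Subset #states

module _ {𝒜 : Set} (M : PPA 𝒜) where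
  open PPA M

  data PPAStep : Fin #states × Bag #data → Act 𝒜 → Fin #states × Bag #data → Set where
    present : ∀ {s α d x′ s′} (x : Bag #data) →
              (s -⟨ α [ +ᵈ d / x′ ]⟩→ s′) ∈ transitions →
              PPAStep (s , ⟅ d ⟆ ∪ x) α (s′ , x′ ∪ x)
    absent  : ∀ {s α d x′ s′} (x : Bag #data) →
              d ∉ᴮ x →
              (s -⟨ α [ -ᵈ d / x′ ]⟩→ s′) ∈ transitions →
              PPAStep (s , x) α (s′ , x′ ∪ x)

  ppaGraph : ProcessGraph 𝒜
  ppaGraph = record
    { lts  = record
      { State   = Fin #states × Bag #data
      ; _-[_]→_ = PPAStep
      ; _↓      = λ (s , _) → s ∈ˢ accepting
      }
    ; root = initial , ∅
    }

infixr 8 _·_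
infixl 7 _∥_
infixl 6 _⊕_

-- Fin n is the set of process identifiers; _⊕_ is the choice operator.
data Proc (𝒜 : Set) (n : ℕ) : Set where
  𝟎 𝟏     : Proc 𝒜 n
  _·_     : Act 𝒜 → Proc 𝒜 n → Proc 𝒜 n
  _⊕_ _∥_ : Proc 𝒜 n → Proc 𝒜 n → Proc 𝒜 n
  var     : Fin n → Proc 𝒜 n

Spec : Set → ℕ → Set
Spec 𝒜 n = Fin n → Proc 𝒜 n

-- There is no constructor for var: the identifiers that may occur are those
-- below a prefix (τ included), whose body is unrestricted.
data Guarded {𝒜 : Set} {n : ℕ} : Proc 𝒜 n → Set where
  𝟎   : Guarded 𝟎
  𝟏   : Guarded 𝟏
  _·_ : ∀ α p → Guarded (α · p)
  _⊕_ : ∀ {p q} → Guarded p → Guarded q → Guarded (p ⊕ q)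
  _∥_ : ∀ {p q} → Guarded p → Guarded q → Guarded (p ∥ q)

WeaklyGuarded : {𝒜 : Set} {n : ℕ} → Spec 𝒜 n → Set
WeaklyGuarded Γ = ∀ X → Guarded (Γ X)

module _ {𝒜 : Set} {n : ℕ} (Γ : Spec 𝒜 n) where

  data BPPStep : Proc 𝒜 n → Act 𝒜 → Proc 𝒜 n → Set where
    prefix : ∀ {α p} → BPPStep (α · p) α p
    sumˡ   : ∀ {α p p′ q} → BPPStep p α p′ → BPPStep (p ⊕ q) α p′
    sumʳ   : ∀ {α p p′ q} → BPPStep p α p′ → BPPStep (q ⊕ p) α p′
    parˡ   : ∀ {α p p′ q} → BPPStep p α p′ → BPPStep (p ∥ q) α (p′ ∥ q)
    parʳ   : ∀ {α p p′ q} → BPPStep p α p′ → BPPStep (q ∥ p) α (q ∥ p′)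
    rec    : ∀ {X α p′} → BPPStep (Γ X) α p′ → BPPStep (var X) α p′

  data BPPAccept : Proc 𝒜 n → Set where
    one  : BPPAccept 𝟏
    sumˡ : ∀ {p q} → BPPAccept p → BPPAccept (p ⊕ q)
    sumʳ : ∀ {p q} → BPPAccept q → BPPAccept (p ⊕ q)
    par  : ∀ {p q} → BPPAccept p → BPPAccept q → BPPAccept (p ∥ q)
    rec  : ∀ {X} → BPPAccept (Γ X) → BPPAccept (var X)

  bppGraph : Fin n → ProcessGraph 𝒜
  bppGraph X = record
    { lts  = record
      { State   = Proc 𝒜 n
      ; _-[_]→_ = BPPStep
      ; _↓      = BPPAccept
      }
    ; root = var X
    }

counter : {𝒜 : Set} (a b c : 𝒜) → PPA 𝒜
counter a b c = record
  { #states     = 1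
  ; #data       = 1
  ; alphabet    = a ∷ b ∷ c ∷ []
  ; transitions = (↑ -⟨ act c [ -ᵈ d / ⟅ d ⟆ ]⟩→ ↑)
                ∷ (↑ -⟨ act a [ +ᵈ d / ⟅ d ⟆ ∪ ⟅ d ⟆ ]⟩→ ↑)
                ∷ (↑ -⟨ act b [ +ᵈ d / ∅ ]⟩→ ↑)
                ∷ []
  ; labels      = Maybe.just (there (there (here refl)))
                ∷ Maybe.just (here refl)
                ∷ Maybe.just (there (here refl))
                ∷ []
  ; initial     = ↑
  ; accepting   = ⁅ ↑ ⁆
  }
  where
  ↑ d : Fin 1
  ↑ = zero
  d = zero

{-# OPTIONS --safe #-}

-- In a process bisimilar to counter value k, the action c is possible exactly
-- when the value has dropped to 0.  It is performed by a single parallel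
-- component, and the moves of that component alone already form a run of the
-- whole process, so one component can count down from k unaided.  All components
-- of reachable processes are among the finitely many subterms of the
-- specification; by the pigeonhole principle processes of two different values
-- share such a component, whose run up to c then reaches 0 from both values.
-- This is absurd, because the effect of a run on the counter is injective.
module Submission where

open import Defs
open import Data.Empty using (⊥; ⊥-elim)
open import Data.Fin.Base using (Fin; zero; toℕ)
open import Data.Fin.Properties using (pigeonhole; toℕ-injective; <⇒≢)
open import Data.List.Base using (List; []; _∷_; _++_; length; concat; tabulate)
import Data.List.Base as List
open import Data.List.Membership.Propositional using (_∈_)
open import Data.List.Membership.Propositional.Properties using (∈-concat⁺′; ∈-tabulate⁺)
open import Data.List.Relation.Binary.Subset.Propositional using (_⊆_)
open import Data.List.Relation.Binary.Subset.Propositional.Properties using (xs⊆xs++ys; xs⊆ys++xs)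
open import Data.List.Relation.Unary.Any using (here; there; index)
open import Data.List.Relation.Unary.Any.Properties using (lookup-index)
open import Data.Nat.Base using (ℕ; zero; suc)
open import Data.Nat.Properties using (suc-injective; n<1+n)
open import Data.Product.Base using (Σ-syntax; ∃-syntax; _×_; _,_; proj₁; proj₂)
open import Data.Sum.Base using (_⊎_; inj₁; inj₂)
open import Data.Sum.Relation.Binary.Pointwise using (inj₁; inj₂)
open import Data.Vec.Base using ([]; _∷_; head)
open import Function.Base using (_∘_)
open import Relation.Binary.Construct.Closure.ReflexiveTransitive using (ε; _◅_)
open import Relation.Binary.PropositionalEquality.Core using (_≡_; _≢_; refl; sym; trans; subst)
open import Relation.Nullary.Negation.Core using (¬_)

-- Applied to the numbers up to `length xs`, one more than there are positions. Comparing positions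
-- instead of elements avoids deciding equality on `A`.
pigeonhole-∈ : {A : Set} {xs : List A} {P : ℕ → A → Set} →
               (∀ k → ∃[ x ] (x ∈ xs × P k x)) →
               ∃[ k ] ∃[ m ] ∃[ x ] (k ≢ m × P k x × P m x)
pigeonhole-∈ {A} {xs} {P} f =
  let i , j , i<j , same = pigeonhole (n<1+n (length xs)) position
  in  toℕ i , toℕ j , List.lookup xs (position i) , <⇒≢ i<j ∘ toℕ-injective ,
      holds i , subst (P (toℕ j) ∘ List.lookup xs) (sym same) (holds j)
  where
  position : Fin (suc (length xs)) → Fin (length xs)
  position i = index (proj₁ (proj₂ (f (toℕ i))))

  holds : ∀ i → P (toℕ i) (List.lookup xs (position i))
  holds i = let _ , x∈xs , Px = f (toℕ i) in subst (P (toℕ i)) (lookup-index x∈xs) Px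

-- The index is the word read before a final `c`, with every τ recorded. Abstracting from the
-- transition relation lets one word label both a run of a process and a run of the counter.
data CanDo {𝒜 S : Set} (_-[_]→_ : S → Act 𝒜 → S → Set) (c : 𝒜) :
           S → List (Act 𝒜) → Set where
  now   : ∀ {s s′} → s -[ act c ]→ s′ → CanDo _-[_]→_ c s []
  later : ∀ {s s′ α w} → s -[ α ]→ s′ → CanDo _-[_]→_ c s′ w →
          CanDo _-[_]→_ c s (α ∷ w)

subterms : {𝒜 : Set} {n : ℕ} → Proc 𝒜 n → List (Proc 𝒜 n)
subterms 𝟎       = 𝟎 ∷ []
subterms 𝟏       = 𝟏 ∷ []
subterms (α · p) = α · p ∷ subterms p
subterms (p ⊕ q) = p ⊕ q ∷ subterms p ++ subterms q
subterms (p ∥ q) = p ∥ q ∷ subterms p ++ subterms q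
subterms (var X) = var X ∷ []

∈-subterms : {𝒜 : Set} {n : ℕ} (p : Proc 𝒜 n) → p ∈ subterms p
∈-subterms 𝟎       = here refl
∈-subterms 𝟏       = here refl
∈-subterms (α · p) = here refl
∈-subterms (p ⊕ q) = here refl
∈-subterms (p ∥ q) = here refl
∈-subterms (var X) = here refl

module _ {𝒜 : Set} {n : ℕ} (Γ : Spec 𝒜 n) (U : List (Proc 𝒜 n))
         (Γ⊆U : ∀ X → subterms (Γ X) ⊆ U) where

  -- An invariant of reachable processes. All of `subterms s`, not just `s`, must lie in `U`, since
  -- a step of `s` can expose any of them.
  data Composed : Proc 𝒜 n → Set where
    component : ∀ {s} → subterms s ⊆ U → Composed s
    _∥_       : ∀ {p q} → Composed p → Composed q → Composed (p ∥ q)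

  -- By induction on the derivation of the step, because `rec` replaces an identifier by its
  -- right-hand side, which is no smaller as a term; there `Γ⊆U` restores the invariant.
  component-step : ∀ {s α p} → subterms s ⊆ U → BPPStep Γ s α p → Composed p
  component-step s⊆U prefix     = component (s⊆U ∘ there)
  component-step s⊆U (sumˡ {p = p} {q = q} t) =
    component-step (s⊆U ∘ there ∘ xs⊆xs++ys (subterms p) (subterms q)) t
  component-step s⊆U (sumʳ {p = p} {q = q} t) =
    component-step (s⊆U ∘ there ∘ xs⊆ys++xs (subterms p) (subterms q)) t
  component-step s⊆U (parˡ {p = p} {q = q} t) =
    component-step (s⊆U ∘ there ∘ xs⊆xs++ys (subterms p) (subterms q)) t
    ∥ component (s⊆U ∘ there ∘ xs⊆ys++xs (subterms q) (subterms p))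
  component-step s⊆U (parʳ {p = p} {q = q} t) =
    component (s⊆U ∘ there ∘ xs⊆xs++ys (subterms q) (subterms p))
    ∥ component-step (s⊆U ∘ there ∘ xs⊆ys++xs (subterms p) (subterms q)) t
  component-step s⊆U (rec {X = X} t) = component-step (Γ⊆U X) t

  composed-step : ∀ {p α p′} → Composed p → BPPStep Γ p α p′ → Composed p′
  composed-step (component s⊆U) t        = component-step s⊆U t
  composed-step (P ∥ Q)         (parˡ t) = composed-step P t ∥ Q
  composed-step (P ∥ Q)         (parʳ t) = P ∥ composed-step Q t

  module _ {c : 𝒜} where

    ∥-canDoˡ : ∀ {p q w} → CanDo (BPPStep Γ) c p w → CanDo (BPPStep Γ) c (p ∥ q) w
    ∥-canDoˡ (now t)     = now (parˡ t)
    ∥-canDoˡ (later t r) = later (parˡ t) (∥-canDoˡ r)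

    ∥-canDoʳ : ∀ {p q w} → CanDo (BPPStep Γ) c q w → CanDo (BPPStep Γ) c (p ∥ q) w
    ∥-canDoʳ (now t)     = now (parʳ t)
    ∥-canDoʳ (later t r) = later (parʳ t) (∥-canDoʳ r)

    -- Parallel components never synchronise, so erasing the moves of the side that does not perform
    -- the final `c` leaves a run of the other side. The word may shrink.
    ∥-canDo⁻ : ∀ {p q w} → CanDo (BPPStep Γ) c (p ∥ q) w →
               (∃[ v ] CanDo (BPPStep Γ) c p v) ⊎ (∃[ v ] CanDo (BPPStep Γ) c q v)
    ∥-canDo⁻ (now (parˡ t)) = inj₁ (_ , now t)
    ∥-canDo⁻ (now (parʳ t)) = inj₂ (_ , now t)
    ∥-canDo⁻ (later (parˡ t) r) with ∥-canDo⁻ r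
    ... | inj₁ (_ , r′) = inj₁ (_ , later t r′)
    ... | inj₂ r′       = inj₂ r′
    ∥-canDo⁻ (later (parʳ t) r) with ∥-canDo⁻ r
    ... | inj₁ r′       = inj₁ r′
    ... | inj₂ (_ , r′) = inj₂ (_ , later t r′)

    -- Projecting repeatedly leads to a single component. Conversely, any run of that component is a
    -- run of `p` with the same word, the other components staying idle.
    component-canDo : ∀ {p w} → Composed p → CanDo (BPPStep Γ) c p w →
      ∃[ s ] (s ∈ U × (∃[ v ] CanDo (BPPStep Γ) c s v) ×
              (∀ {v} → CanDo (BPPStep Γ) c s v → CanDo (BPPStep Γ) c p v))
    component-canDo {p} (component p⊆U) r = p , p⊆U (∈-subterms p) , (_ , r) , λ r′ → r′
    component-canDo (P ∥ Q) r with ∥-canDo⁻ r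
    ... | inj₁ (_ , r′) = let s , s∈U , v , lift = component-canDo P r′
                          in  s , s∈U , v , ∥-canDoˡ ∘ lift
    ... | inj₂ (_ , r′) = let s , s∈U , v , lift = component-canDo Q r′
                          in  s , s∈U , v , ∥-canDoʳ ∘ lift

module Counter {𝒜 : Set} (a b c : 𝒜) where

  -- A τ-step leaves the counter unchanged, as it may be matched by no move.
  data CounterStep : ℕ → Act 𝒜 → ℕ → Set where
    stay : ∀ {k} → CounterStep k τ k
    init : CounterStep 0 (act c) 1
    inc  : ∀ {k} → CounterStep (suc k) (act a) (suc (suc k))
    dec  : ∀ {k} → CounterStep (suc k) (act b) k

  open LTS (ProcessGraph.lts (ppaGraph (counter a b c)))

  ⟨_⟩ : ℕ → State
  ⟨ k ⟩ = zero , k ∷ []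

  value : State → ℕ
  value = head ∘ proj₂

  toCounterStep : ∀ {s α t} → s -[ α ]→ t → CounterStep (value s) α (value t)
  toCounterStep (present (_ ∷ []) (there (here refl)))         = inc
  toCounterStep (present (_ ∷ []) (there (there (here refl)))) = dec
  toCounterStep (absent (_ ∷ []) refl (here refl))             = init
  toCounterStep (absent _ _ (there (there (there ()))))

  counter-no-τ : ∀ {s t} → ¬ s -[ τ ]→ t
  counter-no-τ (present _ (there (there (there ()))))
  counter-no-τ (absent _ _ (there (there (there ()))))

  fromCounterStep : ∀ {k x m} → CounterStep k (act x) m → ⟨ k ⟩ -[ act x ]→ ⟨ m ⟩
  fromCounterStep init = absent {d = zero} (0 ∷ []) refl (here refl)
  fromCounterStep inc  = present (_ ∷ []) (there (here refl))
  fromCounterStep dec  = present (_ ∷ []) (there (there (here refl)))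

  -- Two runs are compared from their end: the final `c` starts at 0, and as the three actions
  -- differ, a label and a target value determine the source.
  counter-canDo-injective : a ≢ b → a ≢ c → b ≢ c →
    ∀ {k m w} → CanDo CounterStep c k w → CanDo CounterStep c m w → k ≡ m
  counter-canDo-injective a≢b a≢c b≢c = injective
    where
    backward : ∀ {k k′ m m′ α} → CounterStep k α k′ → CounterStep m α m′ →
               k′ ≡ m′ → k ≡ m
    backward stay stay eq   = eq
    backward init init _    = refl
    backward init inc  _    = ⊥-elim (a≢c refl)
    backward init dec  _    = ⊥-elim (b≢c refl)
    backward inc  init _    = ⊥-elim (a≢c refl)
    backward inc  inc  eq   = suc-injective eq
    backward inc  dec  _    = ⊥-elim (a≢b refl)
    backward dec  init _    = ⊥-elim (b≢c refl)
    backward dec  inc  _    = ⊥-elim (a≢b refl)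
    backward dec  dec  refl = refl

    c-from-0 : ∀ {k α m} → CounterStep k α m → α ≡ act c → k ≡ 0
    c-from-0 init _    = refl
    c-from-0 inc  refl = ⊥-elim (a≢c refl)
    c-from-0 dec  refl = ⊥-elim (b≢c refl)

    injective : ∀ {k m w} → CanDo CounterStep c k w → CanDo CounterStep c m w → k ≡ m
    injective (now t)     (now u)     = trans (c-from-0 t refl) (sym (c-from-0 u refl))
    injective (later t r) (later u v) = backward t u (injective r v)

module _ {𝒜 : Set} (a b c : 𝒜) {n : ℕ} (Γ : Spec 𝒜 n) (X : Fin n)
         (bisimilar : bppGraph Γ X ≃ ppaGraph (counter a b c)) where

  private
    module B = LTS (ProcessGraph.lts (bppGraph Γ X))
    R = proj₁ bisimilar
    open IsBranchingBisimulation (proj₁ (proj₂ bisimilar))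
    open LTS (ProcessGraph.lts (bppGraph Γ X) ⊎ᴸ ProcessGraph.lts (ppaGraph (counter a b c)))
    open Counter a b c

  infix 4 _∼_
  _∼_ : Proc 𝒜 n → ℕ → Set
  p ∼ k = R (inj₁ p) (inj₂ ⟨ k ⟩)

  ∼-step : ∀ {p α p′ k} → p ∼ k → BPPStep Γ p α p′ →
           ∃[ m ] (CounterStep k α m × p′ ∼ m)
  ∼-step p∼k t with step p∼k (inj₁ t)
  -- The counter has no τ-steps, so the τ-sequence before the match is empty: the counter answers
  -- with one step, or with none for a τ.
  ... | _ , _ , inj₂ u ◅ _ , _                       = ⊥-elim (counter-no-τ u)
  ... | _ , _ , ε , inj₂ (refl , refl) , _ , p′∼k    = _ , stay , p′∼k
  ... | _ , inj₂ (zero , _ ∷ []) , ε , inj₁ (inj₂ u) , _ , p′∼m =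
    _ , toCounterStep u , p′∼m

  ∼-canDo : ∀ {p k w} → p ∼ k → CanDo (BPPStep Γ) c p w → CanDo CounterStep c k w
  ∼-canDo p∼k (now t) with ∼-step p∼k t
  ... | _ , u , _ = now u
  ∼-canDo p∼k (later t r) with ∼-step p∼k t
  ... | _ , u , p′∼m = later u (∼-canDo p′∼m r)

  τ-run : ∀ {p t} → inj₁ p ⇒ t → ∃[ q ] (t ≡ inj₁ q × p B.⇒ q)
  τ-run ε            = _ , refl , ε
  τ-run (inj₁ t ◅ r) = let q , eq , ts = τ-run r in q , eq , t ◅ ts

  ∼-match : ∀ {p k x m} → p ∼ k → CounterStep k (act x) m →
            ∃[ q ] ∃[ p′ ] (p B.⇒ q × BPPStep Γ q (act x) p′ × p′ ∼ m)
  ∼-match p∼k t with step (symmetric p∼k) (inj₂ (fromCounterStep t))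
  ... | _ , _ , r , u , _ , m∼p′ with τ-run r | u
  -- A visible action cannot be matched by staying put, so only a genuine step of the process
  -- remains.
  ... | q , refl , ts | inj₁ (inj₁ u′) = q , _ , ts , u′ , symmetric m∼p′

  τ-canDo : ∀ {p q w} → p B.⇒ q → CanDo (BPPStep Γ) c q w → ∃[ v ] CanDo (BPPStep Γ) c p v
  τ-canDo ε        r = _ , r
  τ-canDo (t ◅ ts) r = _ , later t (proj₂ (τ-canDo ts r))

  -- The counter does `b` until it is 0 and then `c`. The process follows with τ-steps in between,
  -- so the word is only known to exist.
  ∼⇒canDo : ∀ {p} k → p ∼ k → ∃[ w ] CanDo (BPPStep Γ) c p w
  ∼⇒canDo zero    p∼k = let _ , _ , ts , t , _ = ∼-match p∼k init
                        in  τ-canDo ts (now t)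
  ∼⇒canDo (suc k) p∼k = let _ , _ , ts , t , p′∼k = ∼-match p∼k dec
                        in  τ-canDo ts (later t (proj₂ (∼⇒canDo k p′∼k)))

  U : List (Proc 𝒜 n)
  -- The root is listed separately, as it need not occur in any right-hand side.
  U = var X ∷ concat (tabulate (subterms ∘ Γ))

  Γ⊆U : ∀ Y → subterms (Γ Y) ⊆ U
  Γ⊆U Y p∈ = there (∈-concat⁺′ p∈ (∈-tabulate⁺ Y))

  Reached : ℕ → Set
  Reached k = ∃[ p ] (Composed Γ U Γ⊆U p × p ∼ k)

  composed-τ-run : ∀ {p q} → Composed Γ U Γ⊆U p → p B.⇒ q → Composed Γ U Γ⊆U q
  composed-τ-run P ε        = P
  composed-τ-run P (t ◅ ts) = composed-τ-run (composed-step Γ U Γ⊆U P t) ts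

  reached-step : ∀ {k x m} → CounterStep k (act x) m →
                 Reached k → Reached m
  reached-step u (_ , P , p∼k) =
    let _ , p′ , ts , t , p′∼m = ∼-match p∼k u
    in  p′ , composed-step Γ U Γ⊆U (composed-τ-run P ts) t , p′∼m

  reached : ∀ k → Reached k
  reached zero          = var X , component (λ { (here refl) → here refl }) ,
                          proj₂ (proj₂ (proj₂ bisimilar))
  reached (suc zero)    = reached-step init (reached zero)
  reached (suc (suc k)) = reached-step inc (reached (suc k))

  -- Every run of `s` up to `c` counts down from `k`, not just the one found. This universal form
  -- allows a run found for one value to be used for another.
  countingComponent : ∀ k → ∃[ s ] (s ∈ U × (∃[ w ] CanDo (BPPStep Γ) c s w) ×
    (∀ {w} → CanDo (BPPStep Γ) c s w → CanDo CounterStep c k w))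
  countingComponent k =
    let _ , P , p∼k         = reached k
        s , s∈U , run , lift = component-canDo Γ U Γ⊆U P (proj₂ (∼⇒canDo k p∼k))
    in  s , s∈U , run , ∼-canDo p∼k ∘ lift

  not-bisimilar : a ≢ b → a ≢ c → b ≢ c → ⊥
  not-bisimilar a≢b a≢c b≢c =
    let _ , _ , _ , k≢m , ((_ , run) , countsₖ) , (_ , countsₘ) = pigeonhole-∈ countingComponent
    -- The run found for the first value is transferred to both.
    in  k≢m (counter-canDo-injective a≢b a≢c b≢c (countsₖ run) (countsₘ run))

theorem6 : {𝒜 : Set} (a b c : 𝒜) → a ≢ b → a ≢ c → b ≢ c →
    ¬ (Σ[ n ∈ ℕ ] Σ[ Γ ∈ Spec 𝒜 n ] Σ[ X ∈ Fin n ]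
    (WeaklyGuarded Γ × bppGraph Γ X ≃ ppaGraph (counter a b c)))
theorem6 a b c a≢b a≢c b≢c (_ , Γ , X , _ , bisimilar) =
  not-bisimilar a b c Γ X bisimilar a≢b a≢c b≢c
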